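{- Let $\Sigma\subset\mathbb{N}$ be a finite alphabet, let $\varphi:\Sigma^*\to\Sigma^*$ be a Parikh-collinear morphism prolongable on a letter $a$, and let $\mathbf{x}=\varphi^\omega(a)$. Then the additive complexity function $\rho^{\mathrm{add}}_{\mathbf{x}}$ is $k$-automatic for $k=\sum_{b\in\Sigma}|\varphi(b)|_b$. Moreover, a DFAO generating $\rho^{\mathrm{add}}_{\mathbf{x}}$ can be effectively computed from $\varphi$ and $a$.
   Context: A morphism $\varphi:\Sigma^*\to\Sigma^*$ is Parikh-collinear if the Parikh vectors $(|\varphi(b)|_c)_{c\in\Sigma}$, $b\in\Sigma$, are pairwise collinear (rank at most 1). It is prolongable on $a$ if $\varphi(a)$ begins with $a$ and $|\varphi^n(a)|\to\infty$; $\varphi^\omega(a)$ is the resulting infinite fixed point. A sequence is $k$-automatic if some deterministic finite automaton with output, reading the base-$k$ representation of $n$, outputs its $n$th term. Words $u,v$ are additively equivalent if $|u|=|v|$ and $\sum_c c|u|_c=\sum_c c|v|_c$; $\rho^{\mathrm{add}}_{\mathbf{x}}(n)$ is the number of additive equivalence classes of length-$n$ factors of $\mathbf{x}$. -}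

module Defs where

open import Data.Nat using (ℕ; zero; suc; _+_; _*_; _≤_; _<_; _≟_)
open import Data.Nat.DivMod using (_mod_; _/_)
open import Data.Fin using (Fin; fromℕ<)
open import Data.List using (List; []; _∷_; length; map; concatMap; filter; applyUpTo; reverse; foldl; lookup)
open import Data.Nat.ListAction using (sum)
open import Data.List.Membership.Propositional using (_∈_)
open import Data.Product using (Σ; ∃; _×_; _,_)
open import Data.Sum using (_⊎_)
open import Relation.Binary.PropositionalEquality using (_≡_; _≢_)

-- Words over ℕ (the alphabet Σ ⊂ ℕ is given as a duplicate-free list).
Word : Set
Word = List ℕ

occ : ℕ → Word → ℕ
occ c w = length (filter (_≟ c) w)

ext : (ℕ → Word) → Word → Word
ext φ w = concatMap φ w

iter : (ℕ → Word) → ℕ → Word → Word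
iter φ zero    w = w
iter φ (suc n) w = ext φ (iter φ n w)

-- Parikh vectors ψ(u), ψ(v) over Σ are collinear: λ ψ(u) = μ ψ(v) with (λ,μ) ≠ (0,0).
-- (For vectors with nonnegative entries, natural-number scalars suffice.)
Collinear : List ℕ → Word → Word → Set
Collinear Σ' u v =
  ∃ λ l → ∃ λ m → (l ≢ 0 ⊎ m ≢ 0) × (∀ c → c ∈ Σ' → l * occ c u ≡ m * occ c v)

ParikhCollinear : List ℕ → (ℕ → Word) → Set
ParikhCollinear Σ' φ = ∀ b b' → b ∈ Σ' → b' ∈ Σ' → Collinear Σ' (φ b) (φ b')

Prolongable : (ℕ → Word) → ℕ → Set
Prolongable φ a =
  (∃ λ w → φ a ≡ a ∷ w) × (∀ N → ∃ λ n → N ≤ length (iter φ n (a ∷ [])))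

PrefixOf : Word → (ℕ → ℕ) → Set
PrefixOf w x = ∀ i → (p : i < length w) → lookup w (fromℕ< p) ≡ x i

-- x = φ^ω(a): every φ^n(a) is a prefix of x (determines x given prolongability)
IsFixedPoint : (ℕ → Word) → ℕ → (ℕ → ℕ) → Set
IsFixedPoint φ a x = ∀ n → PrefixOf (iter φ n (a ∷ [])) x

factor : (ℕ → ℕ) → ℕ → ℕ → Word
factor x i n = applyUpTo (λ j → x (i + j)) n

AddEq : Word → Word → Set
AddEq u v = (length u ≡ length v) × (sum u ≡ sum v)

AddComplexityIs : (ℕ → ℕ) → ℕ → ℕ → Set
AddComplexityIs x n m =
  Σ (Fin m → ℕ) λ pos →
    (∀ i j → AddEq (factor x (pos i) n) (factor x (pos j) n) → i ≡ j) ×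
    (∀ p → ∃ λ i → AddEq (factor x p n) (factor x (pos i) n))

-- base-k representation, least significant digit first (fuel-bounded);
-- degenerate (empty) when k ≤ 1.
repLSD : (k : ℕ) → ℕ → ℕ → List (Fin k)
repLSD (suc (suc j)) (suc fuel) (suc n) =
  (suc n mod suc (suc j)) ∷ repLSD (suc (suc j)) fuel (suc n / suc (suc j))
repLSD _ _ _ = []

-- canonical base-k representation, most significant digit first, no leading zeros
rep : (k : ℕ) → ℕ → List (Fin k)
rep k n = reverse (repLSD k n n)

record DFAO (k : ℕ) : Set where
  field
    states : ℕ
    start  : Fin states
    δ      : Fin states → Fin k → Fin states
    out    : Fin states → ℕ

run : {k : ℕ} → DFAO k → List (Fin k) → ℕ
run M w = DFAO.out M (foldl (DFAO.δ M) (DFAO.start M) w)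

traceK : List ℕ → (ℕ → Word) → ℕ
traceK Σ' φ = sum (map (λ b → occ b (φ b)) Σ')

{-# OPTIONS --safe #-}

-- The vector (|φ(b)|) is a left eigenvector of the rank one incidence matrix of φ for its trace k,
-- so |φ(φ(w))| = k |φ(w)| for every word w. Since x = φ(x), each position n lies at some offset j
-- in the image of some letter b of x, and z(n) = (b , j) determines z(kn + r) for r < k: z is a
-- fixed point of a k-uniform morphism. Writing A = |φ(a)| and B = sum φ(a), collinearity gives A ·
-- sum φ(w) = B · |φ(w)|, so A · sum x[0..n) − B n depends only on z(n), and the additive class of
-- x[i..i+n) depends only on n, z(i) and z(i+n). An automaton reading n from the most significant
-- digit can maintain the set of all triples (z(i) , z(i+n) , z(i+n+1)), hence outputs the number
-- of classes.

module Submission where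

open import Defs
open import Data.Fin using (Fin; zero; suc; toℕ)
open import Data.Fin.Properties using (toℕ<n; toℕ-fromℕ<)
open import Data.Integer as ℤ using (ℤ; _⊖_)
import Data.Integer.Properties as ℤ
open import Algebra.Properties.AbelianGroup ℤ.+-0-abelianGroup using (∙-cancelˡ)
open import Data.List using (List; []; _∷_; [_]; _++_; _∷ʳ_; length; map; concatMap; filter;
  applyUpTo; upTo; take; foldl; foldr; lookup; removeAt; deduplicate; cartesianProduct)
open import Data.List.Properties using (map-++; map-id; length-++; ++-cancelˡ; ++-identityʳ;
  ∷-injectiveˡ; ∷-injectiveʳ; concatMap-++; length-applyUpTo; applyUpTo-∷ʳ; filter-++;
  filter-accept; filter-reject; reverse-foldl; length-removeAt′)
open import Data.List.Membership.Propositional using (_∈_; find; lose)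
open import Data.List.Membership.Propositional.Properties using (∈-lookup; ∈-++⁺ˡ; ∈-++⁺ʳ; ∈-map⁺;
  ∈-map⁻; ∈-concatMap⁺; ∈-concatMap⁻; ∈-cartesianProduct⁺; ∈-upTo⁺; ∈-upTo⁻; ∈-applyUpTo⁺;
  ∈-filter⁺; ∈-filter⁻; ∈-deduplicate⁺; ∈-deduplicate⁻)
import Data.List.Membership.DecPropositional as DecMembership
open import Data.List.Relation.Unary.All as All using (All; []; _∷_)
import Data.List.Relation.Unary.All.Properties as All
open import Data.List.Relation.Unary.AllPairs using (_∷_)
open import Data.List.Relation.Unary.Any using (Any; here; there; any?; index)
open import Data.List.Relation.Unary.Any.Properties using (lookup-index)
open import Data.List.Relation.Unary.Unique.Propositional using (Unique)
open import Data.List.Relation.Unary.Unique.DecPropositional.Properties using (deduplicate-!)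
open import Data.Nat using (ℕ; zero; suc; _+_; _*_; _∸_; _≤_; _<_; _<?_; _≟_; z≤n; s≤s; NonZero;
  ≢-nonZero)
open import Data.Nat.DivMod using (_/_; _mod_; m%n<n; m≡m%n+[m/n]*n; m/n<m)
open import Data.Nat.Induction using (<-rec)
open import Data.Nat.ListAction using (sum)
open import Data.Nat.ListAction.Properties using (sum-++)
open import Data.Nat.Properties hiding (_≟_)
open import Data.Nat.Tactic.RingSolver using (solve-∀)
open import Data.Product using (Σ; ∃; ∃₂; _×_; _,_; proj₁; proj₂)
open import Data.Product.Properties using (≡-dec)
open import Data.Sum using (_⊎_; inj₁; inj₂; [_,_]′; map₁; map₂)
open import Function using (_∘_; id; const; flip)
open import Relation.Binary.Definitions using (DecidableEquality; tri<; tri≈; tri>)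
open import Relation.Binary.PropositionalEquality hiding ([_])
open import Relation.Nullary using (yes; no; ¬_; contradiction)
open import Relation.Unary using (Decidable)

-- Finite automata

lookup-injective : {A : Set} {xs : List A} → Unique xs →
  ∀ i j → lookup xs i ≡ lookup xs j → i ≡ j
lookup-injective (_ ∷ _) zero zero eq = refl
lookup-injective (x∉ ∷ _) zero (suc j) eq =
  contradiction eq (All.lookup x∉ (∈-lookup j))
lookup-injective (x∉ ∷ _) (suc i) zero eq =
  contradiction (sym eq) (All.lookup x∉ (∈-lookup i))
lookup-injective (_ ∷ u) (suc i) (suc j) eq = cong suc (lookup-injective u i j eq)

-- All possible results of filtering `xs`. This list serves as the finite state space of the
-- automaton, whose states are filtered versions of one fixed list.
subsequences : {A : Set} → List A → List (List A)
subsequences []       = [ [] ]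
subsequences (x ∷ xs) = map (x ∷_) (subsequences xs) ++ subsequences xs

filter∈subsequences : {A : Set} {P : A → Set} (P? : Decidable P) (xs : List A) →
  filter P? xs ∈ subsequences xs
filter∈subsequences P? [] = here refl
filter∈subsequences P? (x ∷ xs) with P? x
... | yes _ = ∈-++⁺ˡ (∈-map⁺ (x ∷_) (filter∈subsequences P? xs))
... | no  _ = ∈-++⁺ʳ (map (x ∷_) (subsequences xs)) (filter∈subsequences P? xs)

-- Closure under a successor function

∈-removeAt : {A : Set} {P : A → Set} {x : A} {xs : List A} (p : Any P xs) → x ∈ xs →
  x ≡ lookup xs (index p) ⊎ x ∈ removeAt xs (index p)
∈-removeAt (here _)  (here eq) = inj₁ eq
∈-removeAt (here _)  (there m) = inj₂ m
∈-removeAt (there _) (here eq) = inj₂ (here eq)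
∈-removeAt (there p) (there m) = map₂ there (∈-removeAt p m)

module _ {A : Set} (_≟_ : DecidableEquality A) (f : A → List A) (Reach : A → Set)
         (reach-step : ∀ {t u} → Reach t → u ∈ f t → Reach u) where
  open DecMembership _≟_ using (_∈?_)

  Closed : List A → Set
  Closed V = ∀ {t u} → t ∈ V → u ∈ f t → u ∈ V

  private
    grow : ∀ m V (todo : List A) → length todo ≤ m →
      (∀ {t} → Reach t → t ∈ V ⊎ t ∈ todo) → (∀ {t} → t ∈ V → Reach t) →
      Σ (List A) λ V′ → (∀ {t} → t ∈ V → t ∈ V′) × (∀ {t} → t ∈ V′ → Reach t) × Closed V′
    grow m V todo len cover sound with any? (_∈? concatMap f V) todo
    ... | no none = V , id , sound , closed
      where
      closed : Closed V
      closed t∈V u∈ft with cover (reach-step (sound t∈V) u∈ft)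
      ... | inj₁ u∈V    = u∈V
      ... | inj₂ u∈todo =
        contradiction (lose u∈todo (∈-concatMap⁺ f (lose t∈V u∈ft))) none
    grow zero V [] len cover sound | yes ()
    grow (suc m) V todo len cover sound | yes p =
      let V′ , V⊆V′ , rest = grow m (new ∷ V) (removeAt todo (index p)) shorter cover′ sound′
      in V′ , V⊆V′ ∘ there , rest
      where
      new = lookup todo (index p)
      shorter : length (removeAt todo (index p)) ≤ m
      shorter = ≤-pred (subst (_≤ suc m) (length-removeAt′ todo (index p)) len)
      cover′ : ∀ {t} → Reach t → t ∈ new ∷ V ⊎ t ∈ removeAt todo (index p)
      cover′ r with cover r
      ... | inj₁ t∈V = inj₁ (there t∈V)
      ... | inj₂ t∈todo = map₁ here (∈-removeAt p t∈todo)
      sound′ : ∀ {t} → t ∈ new ∷ V → Reach t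
      sound′ (there t∈V) = sound t∈V
      sound′ (here refl) with _ , t∈V , new∈ft ← find (∈-concatMap⁻ f (lookup-index p))
        = reach-step (sound t∈V) new∈ft

  saturate : (L : List A) → (∀ {t} → Reach t → t ∈ L) → ∀ {s} → Reach s →
    Σ (List A) λ V → s ∈ V × (∀ {t} → t ∈ V → Reach t) × Closed V
  saturate L reach⊆L {s} rs =
    let V , s⊆V , rest = grow (length L) [ s ] L ≤-refl (inj₂ ∘ reach⊆L) λ { (here refl) → rs }
    in V , s⊆V (here refl) , rest

-- A state is encoded by some position in `E`. As `E` may contain repetitions, the simulation
-- compares states only after `lookup E`, never the positions themselves.
finite-DFAO : {S : Set} {k : ℕ} (E : List S) (δ : S → Fin k → S) → (∀ s d → δ s d ∈ E) →
  ∀ {s₀} → s₀ ∈ E → (out : S → ℕ) →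
  Σ (DFAO k) λ M → ∀ w → run M w ≡ out (foldl δ s₀ w)
finite-DFAO {S} {k} E δ closed {s₀} s₀∈E out =
  M , λ w → cong out (sim w _ _ (sym (lookup-index s₀∈E)))
  where
  δ′ : Fin (length E) → Fin k → Fin (length E)
  δ′ i d = index (closed (lookup E i) d)
  M : DFAO k
  M = record { states = length E ; start = index s₀∈E ; δ = δ′ ; out = out ∘ lookup E }
  sim : ∀ w i s → lookup E i ≡ s → lookup E (foldl δ′ i w) ≡ foldl δ s w
  sim [] i s eq = eq
  sim (d ∷ w) i s refl = sim w _ _ (sym (lookup-index (closed (lookup E i) d)))

-- Induction along base-k digits

module _ (j : ℕ) where
  private
    k : ℕ
    k = suc (suc j)

  -- Horner's scheme: reading a further digit d after the digits of n gives d + nk. Since `rep`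
  -- reverses `repLSD`, the left fold becomes a right fold over `repLSD`, which follows its
  -- recursion; fuel n suffices because n / k < n for n > 0.
  rep-induction : {S : Set} (δ : S → Fin k → S) {s₀ : S} (P : ℕ → S → Set) → P 0 s₀ →
    (∀ n d {s} → P n s → P (toℕ d + n * k) (δ s d)) →
    ∀ n → P n (foldl δ s₀ (rep k n))
  rep-induction {S} δ {s₀} P p₀ p-step n =
    subst (P n) (sym (reverse-foldl δ s₀ (repLSD k n n))) (go n n ≤-refl)
    where
    go : ∀ fuel n → n ≤ fuel → P n (foldr (flip δ) s₀ (repLSD k fuel n))
    go zero    zero    _ = p₀
    go (suc _) zero    _ = p₀
    go (suc fuel) n@(suc _) n≤ =
      subst (λ m → P m (foldr (flip δ) s₀ (repLSD k (suc fuel) n))) eq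
        (p-step (n / k) (n mod k)
          (go fuel (n / k) (≤-pred (≤-trans (m/n<m n k (s≤s (s≤s z≤n))) n≤))))
      where
      eq : toℕ (n mod k) + (n / k) * k ≡ n
      eq = trans (cong (_+ (n / k) * k) (toℕ-fromℕ< (m%n<n n k))) (sym (m≡m%n+[m/n]*n n k))

  -- Counting values along a fixed point of a k-uniform morphism

  module _ {Q W : Set} (_≟Q_ : DecidableEquality Q) (_≟W_ : DecidableEquality W)
           (val : Q → Q → W) (z : ℕ → Q) (ψ : Q → ℕ → Q)
           (z-rec : ∀ n {r} → r < k → z (r + n * k) ≡ ψ (z n) r)
           (E : List Q) (z∈E : ∀ n → z n ∈ E) where

    private
      Triple : Set
      Triple = Q × Q × Q

      _≟T_ : DecidableEquality Triple
      _≟T_ = ≡-dec _≟Q_ (≡-dec _≟Q_ _≟Q_)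

      open DecMembership _≟T_ using (_∈?_)

      L : List Triple
      L = cartesianProduct E (cartesianProduct E E)

      -- The third entry is there because adding the next digits of i and n may carry.
      triple : ℕ → ℕ → Triple
      triple n i = z i , z (i + n) , z (suc (i + n))

      triple∈L : ∀ n i → triple n i ∈ L
      triple∈L n i =
        ∈-cartesianProduct⁺ (z∈E i) (∈-cartesianProduct⁺ (z∈E (i + n)) (z∈E (suc (i + n))))

      -- The letter at position t of the image of the two-letter word q q′ under the k-uniform
      -- morphism `ψ`; positions from k on lie in the second block.
      ψ₂ : Q → Q → ℕ → Q
      ψ₂ q q′ t with t <? k
      ... | yes _ = ψ q t
      ... | no  _ = ψ q′ (t ∸ k)

      z-rec₂ : ∀ n {t} → t < k + k → z (t + n * k) ≡ ψ₂ (z n) (z (suc n)) t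
      z-rec₂ n {t} t<2k with t <? k
      ... | yes t<k = z-rec n t<k
      ... | no  t≮k = trans (cong z eq) (z-rec (suc n)
          (+-cancelˡ-< k (t ∸ k) k (subst (_< k + k) (sym (m+[n∸m]≡n k≤t)) t<2k)))
        where
        k≤t = ≮⇒≥ t≮k
        eq : t + n * k ≡ (t ∸ k) + suc n * k
        eq = trans (cong (_+ n * k) (sym (m∸n+n≡m k≤t))) (+-assoc (t ∸ k) k (n * k))

      step₁ : ℕ → Triple → ℕ → Triple
      step₁ s (p , q , q′) r = ψ p r , ψ₂ q q′ (r + s) , ψ₂ q q′ (suc (r + s))

      step : ℕ → Triple → List Triple
      step s t = map (step₁ s t) (upTo k)

      -- The end position of the new factor is (r + s) + (i + n)k, which lies in the block of i + n
      -- or, after a carry, of i + n + 1. Both of these letters are in the old triple.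
      triple-step : ∀ n i {r s} → r < k → s < k →
        triple (s + n * k) (r + i * k) ≡ step₁ s (triple n i) r
      triple-step n i {r} {s} r<k s<k =
        cong₂ _,_ (z-rec i r<k) (cong₂ _,_
          (trans (cong z eq) (z-rec₂ (i + n) (≤-trans (n≤1+n _) r+s<2k)))
          (trans (cong (z ∘ suc) eq) (z-rec₂ (i + n) r+s<2k)))
        where
        eq : (r + i * k) + (s + n * k) ≡ (r + s) + (i + n) * k
        eq = lemma r s i n k
          where
          lemma : ∀ r s i n k → (r + i * k) + (s + n * k) ≡ (r + s) + (i + n) * k
          lemma = solve-∀
        -- As r and s are at most k - 1, even the position r + s + 1 needed for the third entry
        -- stays within two blocks.
        r+s<2k : suc (suc (r + s)) ≤ k + k
        r+s<2k = subst (_≤ k + k) (+-suc (suc r) s) (+-mono-≤ r<k s<k)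

      Occurs : ℕ → Triple → Set
      Occurs n t = ∃ λ i → t ≡ triple n i

      occurs-step : ∀ n {s t u} → s < k → Occurs n t → u ∈ step s t → Occurs (s + n * k) u
      occurs-step n {s} s<k (i , refl) u∈ with r , r∈ , refl ← ∈-map⁻ (step₁ s (triple n i)) u∈ =
        r + i * k , sym (triple-step n i (∈-upTo⁻ r∈) s<k)

      -- Completeness of `step`: dividing i by k with remainder shows that the triple at i arises
      -- from the triple at i / k.
      ∈-step : ∀ n {s} i → s < k → triple (s + n * k) i ∈ step s (triple n (i / k))
      ∈-step n {s} i s<k = subst (_∈ step s (triple n (i / k)))
        (trans (sym (triple-step n (i / k) (m%n<n i k) s<k))
               (cong (triple (s + n * k)) (sym (m≡m%n+[m/n]*n i k))))
        (∈-map⁺ (step₁ s (triple n (i / k))) (∈-upTo⁺ (m%n<n i k)))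

      Represents : ℕ → List Triple → Set
      Represents n U = (∀ {t} → t ∈ U → Occurs n t) × (∀ i → triple n i ∈ U)

      -- Filtering a fixed list leaves finitely many possible states.
      normalise : List Triple → List Triple
      normalise U = filter (_∈? U) L

      normalise-represents : ∀ {n U} → Represents n U → Represents n (normalise U)
      normalise-represents {n} {U} (sound , complete) =
        (λ t∈ → sound (proj₂ (∈-filter⁻ (_∈? U) {xs = L} t∈))) ,
        (λ i → ∈-filter⁺ (_∈? U) (triple∈L n i) (complete i))

      -- A leading zero digit turns the triples for n = 0 into triples for n = 0, and every index is
      -- reached from 0 in this way.
      initial : ∃ (Represents 0)
      initial with V , t₀∈V , sound , closed ←
        saturate _≟T_ (step 0) (Occurs 0) (occurs-step 0 {0} 0<1+n) L
          (λ { (i , refl) → triple∈L 0 i }) {triple 0 0} (0 , refl) =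
        V , sound , <-rec _ complete
        where
        complete : ∀ i → (∀ {i′} → i′ < i → triple 0 i′ ∈ V) → triple 0 i ∈ V
        complete zero      _  = t₀∈V
        complete i@(suc _) ih = closed (ih (m/n<m i k (s≤s (s≤s z≤n)))) (∈-step 0 i 0<1+n)

      δ : List Triple → Fin k → List Triple
      δ U d = normalise (concatMap (step (toℕ d)) U)

      δ-represents : ∀ n d {U} → Represents n U → Represents (toℕ d + n * k) (δ U d)
      δ-represents n d {U} (sound , complete) = normalise-represents
        ( (λ u∈ → let t , t∈U , u∈step = find (∈-concatMap⁻ (step (toℕ d)) u∈)
                  in occurs-step n (toℕ<n d) (sound t∈U) u∈step)
        , (λ i → ∈-concatMap⁺ (step (toℕ d)) (lose (complete (i / k)) (∈-step n i (toℕ<n d)))))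

      values : List Triple → List W
      values U = deduplicate _≟W_ (map (λ (p , q , _) → val p q) U)

    count-values : Σ (DFAO k) λ M → ∀ n → Σ (Fin (run M (rep k n)) → ℕ) λ pos →
      let v = λ i → val (z i) (z (i + n)) in
      (∀ i j → v (pos i) ≡ v (pos j) → i ≡ j) × (∀ p → ∃ λ i → v p ≡ v (pos i))
    count-values with M , run-M ← finite-DFAO (subsequences L) δ
                         (λ U d → filter∈subsequences (_∈? concatMap (step (toℕ d)) U) L)
                         -- The start state is `normalise` of the initial list, so it too is a
                         -- subsequence of `L`.
                         (filter∈subsequences (_∈? proj₁ initial) L) (length ∘ values) =
      M , λ n → subst (λ m → Σ (Fin m → ℕ) (Enumerates n)) (sym (run-M (rep k n)))
            (enumerate n
              (rep-induction δ Represents (normalise-represents (proj₂ initial)) δ-represents n))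
      where
      Enumerates : (n : ℕ) {m : ℕ} → (Fin m → ℕ) → Set
      Enumerates n pos = let v = λ i → val (z i) (z (i + n)) in
        (∀ i j → v (pos i) ≡ v (pos j) → i ≡ j) × (∀ p → ∃ λ i → v p ≡ v (pos i))
      enumerate : ∀ n {U} → Represents n U → Σ (Fin (length (values U)) → ℕ) (Enumerates n)
      enumerate n {U} (sound , complete) = pos , injective , covering
        where
        v : ℕ → W
        v i = val (z i) (z (i + n))
        f : Triple → W
        f (p , q , _) = val p q
        witness : ∀ i → ∃ λ p → lookup (values U) i ≡ v p
        witness i
          with _ , t∈U , eq ← ∈-map⁻ f
            (∈-deduplicate⁻ _≟W_ (map f U) (∈-lookup {xs = values U} i))
          with p , refl ← sound t∈U = p , eq
        pos : Fin (length (values U)) → ℕ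
        pos = proj₁ ∘ witness
        injective : ∀ i j → v (pos i) ≡ v (pos j) → i ≡ j
        injective i j eq = lookup-injective (deduplicate-! _≟W_ (map f U)) i j
          (trans (proj₂ (witness i)) (trans eq (sym (proj₂ (witness j)))))
        covering : ∀ p → ∃ λ i → v p ≡ v (pos i)
        covering p = index v∈ , trans (lookup-index v∈) (proj₂ (witness (index v∈)))
          where
          v∈ : v p ∈ values U
          v∈ = ∈-deduplicate⁺ _≟W_ (∈-map⁺ f (complete p))

-- Parikh-collinear morphisms

-- A linear functional of the Parikh vector: `const 1` gives the length, `id` the letter sum,
-- `λ b → occ c [ b ]` the number of occurrences of c, and `length ∘ φ` the length of the image.
-- Collinearity is exploited once for all of these.
weigh : (ℕ → ℕ) → Word → ℕ
weigh f w = sum (map f w)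

weigh-++ : ∀ f u v → weigh f (u ++ v) ≡ weigh f u + weigh f v
weigh-++ f u v = trans (cong sum (map-++ f u v)) (sum-++ (map f u) (map f v))

weigh-0 : ∀ w → weigh (const 0) w ≡ 0
weigh-0 []      = refl
weigh-0 (_ ∷ w) = weigh-0 w

weigh-1 : ∀ w → weigh (const 1) w ≡ length w
weigh-1 []      = refl
weigh-1 (_ ∷ w) = cong suc (weigh-1 w)

weigh-+ : ∀ f g w → weigh (λ c → f c + g c) w ≡ weigh f w + weigh g w
weigh-+ f g []      = refl
weigh-+ f g (c ∷ w) =
  trans (cong (f c + g c +_) (weigh-+ f g w)) (lemma (f c) (g c) (weigh f w) (weigh g w))
  where
  lemma : ∀ a b c d → (a + b) + (c + d) ≡ (a + c) + (b + d)
  lemma = solve-∀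

weigh-* : ∀ l f w → weigh (λ c → l * f c) w ≡ l * weigh f w
weigh-* l f []      = sym (*-zeroʳ l)
weigh-* l f (c ∷ w) = trans (cong (l * f c +_) (weigh-* l f w)) (sym (*-distribˡ-+ l (f c) _))

weigh-cong : ∀ {f g} w → (∀ {c} → c ∈ w → f c ≡ g c) → weigh f w ≡ weigh g w
weigh-cong []      eq = refl
weigh-cong (c ∷ w) eq = cong₂ _+_ (eq (here refl)) (weigh-cong w (eq ∘ there))

weigh-ext : ∀ f φ w → weigh f (ext φ w) ≡ weigh (weigh f ∘ φ) w
weigh-ext f φ []      = refl
weigh-ext f φ (b ∷ w) =
  trans (weigh-++ f (φ b) (ext φ w)) (cong (weigh f (φ b) +_) (weigh-ext f φ w))

length-ext : ∀ φ w → length (ext φ w) ≡ weigh (length ∘ φ) w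
length-ext φ []      = refl
length-ext φ (b ∷ w) = trans (length-++ (φ b)) (cong (length (φ b) +_) (length-ext φ w))

occ-∷ : ∀ c b w → occ c (b ∷ w) ≡ occ c [ b ] + occ c w
occ-∷ c b w = trans (cong length (filter-++ (_≟ c) [ b ] w)) (length-++ (filter (_≟ c) [ b ]))

occ-weigh : ∀ c w → weigh (λ b → occ c [ b ]) w ≡ occ c w
occ-weigh c []      = refl
occ-weigh c (b ∷ w) = trans (cong (occ c [ b ] +_) (occ-weigh c w)) (sym (occ-∷ c b w))

occ-single-refl : ∀ b → occ b [ b ] ≡ 1
occ-single-refl b = cong length (filter-accept (_≟ b) {xs = []} refl)

occ-single-≢ : ∀ {b c} → b ≢ c → occ c [ b ] ≡ 0
occ-single-≢ {c = c} b≢c = cong length (filter-reject (_≟ c) {xs = []} b≢c)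

weigh-occ-single : ∀ (f : ℕ → ℕ) {b alphabet} → Unique alphabet → b ∈ alphabet →
  weigh (λ c → occ c [ b ] * f c) alphabet ≡ f b
weigh-occ-single f {b} {_ ∷ cs} (b∉ ∷ _) (here refl) = trans
  (cong₂ (λ m n → m * f b + n) (occ-single-refl b)
    (trans (weigh-cong cs (λ {c} c∈ → cong (_* f c) (occ-single-≢ (All.lookup b∉ c∈)))) (weigh-0 cs)))
  (trans (+-identityʳ _) (*-identityˡ (f b)))
weigh-occ-single f {b} {c ∷ cs} (c∉ ∷ u) (there b∈) =
  cong₂ (λ m n → m * f c + n) (occ-single-≢ (All.lookup c∉ b∈ ∘ sym)) (weigh-occ-single f u b∈)

-- Grouping the letters of w by value: each has exactly one place in the duplicate-free alphabet.
-- Thus identities between Parikh vectors pass to every weight.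
weigh-occ : ∀ (f : ℕ → ℕ) {alphabet} → Unique alphabet → ∀ {w} → All (_∈ alphabet) w →
  weigh (λ c → occ c w * f c) alphabet ≡ weigh f w
weigh-occ f {alphabet} u [] = weigh-0 alphabet
weigh-occ f {alphabet} u {b ∷ w} (b∈ ∷ w⊆) = begin
  weigh (λ c → occ c (b ∷ w) * f c) alphabet
    ≡⟨ weigh-cong alphabet (λ {c} _ →
         trans (cong (_* f c) (occ-∷ c b w)) (*-distribʳ-+ (f c) (occ c [ b ]) _)) ⟩
  weigh (λ c → occ c [ b ] * f c + occ c w * f c) alphabet
    ≡⟨ weigh-+ (λ c → occ c [ b ] * f c) (λ c → occ c w * f c) alphabet ⟩
  weigh (λ c → occ c [ b ] * f c) alphabet + weigh (λ c → occ c w * f c) alphabet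
    ≡⟨ cong₂ _+_ (weigh-occ-single f u b∈) (weigh-occ f u w⊆) ⟩
  f b + weigh f w ∎
  where open ≡-Reasoning

-- Prefixes and factors of sequences

applyUpTo-cong : {A : Set} {f g : ℕ → A} → (∀ i → f i ≡ g i) → ∀ n → applyUpTo f n ≡ applyUpTo g n
applyUpTo-cong eq zero    = refl
applyUpTo-cong eq (suc n) = cong₂ _∷_ (eq 0) (applyUpTo-cong (eq ∘ suc) n)

applyUpTo-+ : {A : Set} (f : ℕ → A) → ∀ m n →
  applyUpTo f (m + n) ≡ applyUpTo f m ++ applyUpTo (f ∘ (m +_)) n
applyUpTo-+ f zero    n = refl
applyUpTo-+ f (suc m) n = cong (f 0 ∷_) (applyUpTo-+ (f ∘ suc) m n)

take-applyUpTo : {A : Set} (f : ℕ → A) → ∀ {m n} → m ≤ n → take m (applyUpTo f n) ≡ applyUpTo f m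
take-applyUpTo f z≤n       = refl
take-applyUpTo f (s≤s m≤n) = cong (f 0 ∷_) (take-applyUpTo (f ∘ suc) m≤n)

factor-+ : ∀ x i m n → factor x i (m + n) ≡ factor x i m ++ factor x (i + m) n
factor-+ x i m n = trans (applyUpTo-+ _ m n)
  (cong (factor x i m ++_) (applyUpTo-cong (λ j → cong x (sym (+-assoc i m j))) n))

length-factor : ∀ x i n → length (factor x i n) ≡ n
length-factor x i n = length-applyUpTo _ n

PrefixOf⇒≡factor : ∀ w x → PrefixOf w x → w ≡ factor x 0 (length w)
PrefixOf⇒≡factor []      x p = refl
PrefixOf⇒≡factor (c ∷ w) x p =
  cong₂ _∷_ (p 0 (s≤s z≤n)) (PrefixOf⇒≡factor w (x ∘ suc) λ i i< → p (suc i) (s≤s i<))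

++-≡factorˡ : ∀ u {v x} → u ++ v ≡ factor x 0 (length (u ++ v)) → u ≡ factor x 0 (length u)
++-≡factorˡ []      eq = refl
++-≡factorˡ (c ∷ u) eq = cong₂ _∷_ (∷-injectiveˡ eq) (++-≡factorˡ u (∷-injectiveʳ eq))

-- Weights and lengths of images under a collinear morphism

module _ (Σ' : List ℕ) (uniq : Unique Σ') (φ : ℕ → Word) (a : ℕ)
         (closed : ∀ b → b ∈ Σ' → All (_∈ Σ') (φ b)) (a∈Σ' : a ∈ Σ')
         (collinear : ParikhCollinear Σ' φ) (prolongable : Prolongable φ a) where

  private
    k A B : ℕ
    k = traceK Σ' φ
    A = length (φ a)
    B = sum (φ a)

    A≢0 : A ≢ 0
    A≢0 eq with () ← trans (sym (cong length (proj₂ (proj₁ prolongable)))) eq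

    instance
      A-nonZero : NonZero A
      A-nonZero = ≢-nonZero A≢0

    ext-closed : ∀ {w} → All (_∈ Σ') w → All (_∈ Σ') (ext φ w)
    ext-closed []        = []
    ext-closed (b∈ ∷ w⊆) = All.++⁺ (closed _ b∈) (ext-closed w⊆)

    -- Collinearity gives l ψ(φ(b)) = m ψ(φ(a)) for the Parikh vectors ψ, hence the same relation
    -- for every weight. For the weight `const 1` it reads l |φ(b)| = m A, which allows m to be
    -- eliminated and l to be cancelled.
    weigh-φ : ∀ f {b} → b ∈ Σ' → A * weigh f (φ b) ≡ length (φ b) * weigh f (φ a)
    weigh-φ f {b} b∈ with collinear b a b∈ a∈Σ'
    ... | l , m , nontrivial , eq = *-cancelˡ-≡ _ _ l {{≢-nonZero l≢0}} (begin
      l * (A * weigh f (φ b))          ≡⟨ swap l A _ ⟩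
      A * (l * weigh f (φ b))          ≡⟨ cong (A *_) (scaled f) ⟩
      A * (m * weigh f (φ a))          ≡⟨ lemma A m _ ⟩
      (m * A) * weigh f (φ a)          ≡⟨ cong (_* weigh f (φ a)) lengths ⟨
      (l * length (φ b)) * weigh f (φ a) ≡⟨ *-assoc l _ _ ⟩
      l * (length (φ b) * weigh f (φ a)) ∎)
      where
      open ≡-Reasoning
      swap : ∀ a b c → a * (b * c) ≡ b * (a * c)
      swap = solve-∀
      lemma : ∀ a b c → a * (b * c) ≡ (b * a) * c
      lemma = solve-∀
      scaled : ∀ f → l * weigh f (φ b) ≡ m * weigh f (φ a)
      scaled f = begin
        l * weigh f (φ b)                         ≡⟨ cong (l *_) (weigh-occ f uniq (closed b b∈)) ⟨
        l * weigh (λ c → occ c (φ b) * f c) Σ'    ≡⟨ weigh-* l _ Σ' ⟨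
        weigh (λ c → l * (occ c (φ b) * f c)) Σ'
          ≡⟨ weigh-cong Σ' (λ {c} c∈ → trans (sym (*-assoc l _ (f c)))
                                (trans (cong (_* f c) (eq c c∈)) (*-assoc m _ (f c)))) ⟩
        weigh (λ c → m * (occ c (φ a) * f c)) Σ'  ≡⟨ weigh-* m _ Σ' ⟩
        m * weigh (λ c → occ c (φ a) * f c) Σ'    ≡⟨ cong (m *_) (weigh-occ f uniq (closed a a∈Σ')) ⟩
        m * weigh f (φ a) ∎
      lengths : l * length (φ b) ≡ m * A
      lengths = subst₂ (λ u v → l * u ≡ m * v) (weigh-1 (φ b)) (weigh-1 (φ a)) (scaled (const 1))
      -- If l = 0 then m A = 0, and A ≠ 0 forces m = 0, against the nontriviality of the scalars.
      l≢0 : l ≢ 0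
      l≢0 l≡0 = [ (λ l≢0 → l≢0 l≡0) ,
                  (λ m≢0 → [ m≢0 , A≢0 ]′ (m*n≡0⇒m≡0∨n≡0 m
                    (trans (sym lengths) (cong (_* length (φ b)) l≡0)))) ]′ nontrivial

    weigh-ext-φ : ∀ f {w} → All (_∈ Σ') w →
      A * weigh f (ext φ w) ≡ length (ext φ w) * weigh f (φ a)
    weigh-ext-φ f [] = *-zeroʳ A
    weigh-ext-φ f {b ∷ w} (b∈ ∷ w⊆) = begin
      A * weigh f (φ b ++ ext φ w)                  ≡⟨ cong (A *_) (weigh-++ f (φ b) (ext φ w)) ⟩
      A * (weigh f (φ b) + weigh f (ext φ w))       ≡⟨ *-distribˡ-+ A (weigh f (φ b)) _ ⟩
      A * weigh f (φ b) + A * weigh f (ext φ w)     ≡⟨ cong₂ _+_ (weigh-φ f b∈) (weigh-ext-φ f w⊆) ⟩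
      length (φ b) * weigh f (φ a) + length (ext φ w) * weigh f (φ a)
                                                    ≡⟨ *-distribʳ-+ (weigh f (φ a)) (length (φ b)) _ ⟨
      (length (φ b) + length (ext φ w)) * weigh f (φ a) ≡⟨ cong (_* weigh f (φ a)) (length-++ (φ b)) ⟨
      length (φ b ++ ext φ w) * weigh f (φ a) ∎
      where open ≡-Reasoning

    -- The sum of |φ(a)|_b |φ(b)| over b becomes A times the trace, because collinearity turns each
    -- summand into A |φ(b)|_b.
    length-φ²-a : weigh (length ∘ φ) (φ a) ≡ A * k
    length-φ²-a = begin
      weigh (length ∘ φ) (φ a)                   ≡⟨ weigh-occ (length ∘ φ) uniq (closed a a∈Σ') ⟨
      weigh (λ b → occ b (φ a) * length (φ b)) Σ' ≡⟨ weigh-cong Σ' diagonal ⟩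
      weigh (λ b → A * occ b (φ b)) Σ'           ≡⟨ weigh-* A _ Σ' ⟩
      A * k ∎
      where
      open ≡-Reasoning
      diagonal : ∀ {b} → b ∈ Σ' → occ b (φ a) * length (φ b) ≡ A * occ b (φ b)
      diagonal {b} b∈ = begin
        occ b (φ a) * length (φ b)   ≡⟨ *-comm (occ b (φ a)) _ ⟩
        length (φ b) * occ b (φ a)   ≡⟨ cong (length (φ b) *_) (occ-weigh b (φ a)) ⟨
        length (φ b) * weigh (λ c → occ b [ c ]) (φ a) ≡⟨ weigh-φ _ b∈ ⟨
        A * weigh (λ c → occ b [ c ]) (φ b) ≡⟨ cong (A *_) (occ-weigh b (φ b)) ⟩
        A * occ b (φ b) ∎

    -- Common end of the two eigenvalue identities below: one for the image of a letter, one for the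
    -- image of a word.
    scale-by-k : ∀ w v → A * weigh (length ∘ φ) w ≡ v * weigh (length ∘ φ) (φ a) →
      length (ext φ w) ≡ v * k
    scale-by-k w v eq = *-cancelˡ-≡ _ _ A (begin
      A * length (ext φ w)           ≡⟨ cong (A *_) (length-ext φ w) ⟩
      A * weigh (length ∘ φ) w       ≡⟨ eq ⟩
      v * weigh (length ∘ φ) (φ a)   ≡⟨ cong (v *_) length-φ²-a ⟩
      v * (A * k)                    ≡⟨ lemma v A k ⟩
      A * (v * k)                    ∎)
      where
      open ≡-Reasoning
      lemma : ∀ a b c → a * (b * c) ≡ b * (a * c)
      lemma = solve-∀

    length-φ² : ∀ {b} → b ∈ Σ' → length (ext φ (φ b)) ≡ length (φ b) * k
    length-φ² {b} b∈ = scale-by-k (φ b) (length (φ b)) (weigh-φ (length ∘ φ) b∈)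

    length-ext² : ∀ {w} → All (_∈ Σ') w → length (ext φ (ext φ w)) ≡ length (ext φ w) * k
    length-ext² {w} w⊆ = scale-by-k (ext φ w) (length (ext φ w)) (weigh-ext-φ (length ∘ φ) w⊆)

    iter-closed : ∀ n → All (_∈ Σ') (iter φ n [ a ])
    iter-closed zero    = a∈Σ' ∷ []
    iter-closed (suc n) = ext-closed (iter-closed n)

  -- From the first iterate on, lengths are multiplied by k, so k ≤ 1 would keep them bounded by A,
  -- against prolongability.
  1<traceK : 1 < k
  1<traceK = ≰⇒> λ k≤1 → let n , A<n = proj₂ prolongable (suc A) in <⇒≱ A<n (bounded k≤1 n)
    where
    bounded : k ≤ 1 → ∀ n → length (iter φ n [ a ]) ≤ A
    -- Two base cases, since the factor k is available only for words that are already images.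
    bounded k≤1 zero          = n≢0⇒n>0 A≢0
    bounded k≤1 (suc zero)    = ≤-reflexive (cong length (++-identityʳ (φ a)))
    bounded k≤1 (suc (suc n)) = begin
      length (ext φ (ext φ (iter φ n [ a ])))  ≡⟨ length-ext² (iter-closed n) ⟩
      length (ext φ (iter φ n [ a ])) * k      ≤⟨ *-monoʳ-≤ (length (ext φ (iter φ n [ a ]))) k≤1 ⟩
      length (ext φ (iter φ n [ a ])) * 1      ≡⟨ *-identityʳ _ ⟩
      length (iter φ (suc n) [ a ])            ≤⟨ bounded k≤1 (suc n) ⟩
      A ∎
      where open ≤-Reasoning

  -- Parent letters and offsets in the fixed point

  module _ (x : ℕ → ℕ) (fixed : IsFixedPoint φ a x) where
    private
      iter-prefix : ∀ n → iter φ n [ a ] ≡ factor x 0 (length (iter φ n [ a ]))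
      iter-prefix n = PrefixOf⇒≡factor _ x (fixed n)

      -- In x = φ(x), this is the position at which the image of the letter `x m` begins.
      P : ℕ → ℕ
      P m = length (ext φ (factor x 0 m))

      -- The identity x = φ(x) on prefixes: a prefix of length m is a prefix of some iterate φⁿ(a),
      -- so its image is a prefix of the next iterate, and therefore of x.
      ext-factor : ∀ m → ext φ (factor x 0 m) ≡ factor x 0 (P m)
      ext-factor m
        with n , m≤ ← proj₂ prolongable m
        with d , eq ← m≤n⇒∃[o]m+o≡n m≤ =
        ++-≡factorˡ (ext φ (factor x 0 m))
          (subst (λ w → w ≡ factor x 0 (length w)) split (iter-prefix (suc n)))
        where
        open ≡-Reasoning
        split : iter φ (suc n) [ a ] ≡ ext φ (factor x 0 m) ++ ext φ (factor x m d)
        split = begin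
          ext φ (iter φ n [ a ])                         ≡⟨ cong (ext φ) (iter-prefix n) ⟩
          ext φ (factor x 0 (length (iter φ n [ a ])))   ≡⟨ cong (ext φ ∘ factor x 0) eq ⟨
          ext φ (factor x 0 (m + d))                     ≡⟨ cong (ext φ) (factor-+ x 0 m d) ⟩
          ext φ (factor x 0 m ++ factor x m d)           ≡⟨ concatMap-++ φ (factor x 0 m) _ ⟩
          ext φ (factor x 0 m) ++ ext φ (factor x m d)   ∎

      factor-closed : ∀ m → All (_∈ Σ') (factor x 0 m)
      factor-closed m
        with n , m≤ ← proj₂ prolongable m
        with d , eq ← m≤n⇒∃[o]m+o≡n m≤ =
        All.++⁻ˡ (factor x 0 m) (subst (All (_∈ Σ'))
          (trans (iter-prefix n) (trans (cong (factor x 0) (sym eq)) (factor-+ x 0 m d))) (iter-closed n))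

      x∈Σ' : ∀ m → x m ∈ Σ'
      x∈Σ' m = All.lookup (factor-closed (suc m)) (∈-applyUpTo⁺ x ≤-refl)

      ext-factor-suc : ∀ m → ext φ (factor x 0 (suc m)) ≡ ext φ (factor x 0 m) ++ φ (x m)
      ext-factor-suc m = begin
        ext φ (factor x 0 (suc m))                   ≡⟨ cong (ext φ) (applyUpTo-∷ʳ x m) ⟨
        ext φ (factor x 0 m ∷ʳ x m)                  ≡⟨ concatMap-++ φ (factor x 0 m) [ x m ] ⟩
        ext φ (factor x 0 m) ++ (φ (x m) ++ [])      ≡⟨ cong (ext φ (factor x 0 m) ++_) (++-identityʳ (φ (x m))) ⟩
        ext φ (factor x 0 m) ++ φ (x m)              ∎
        where open ≡-Reasoning

      P-suc : ∀ m → P (suc m) ≡ P m + length (φ (x m))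
      P-suc m = trans (cong length (ext-factor-suc m)) (length-++ (ext φ (factor x 0 m)))

      φ-factor : ∀ m → φ (x m) ≡ factor x (P m) (length (φ (x m)))
      φ-factor m = ++-cancelˡ (factor x 0 (P m)) _ _ (begin
        factor x 0 (P m) ++ φ (x m)           ≡⟨ cong (_++ φ (x m)) (ext-factor m) ⟨
        ext φ (factor x 0 m) ++ φ (x m)       ≡⟨ ext-factor-suc m ⟨
        ext φ (factor x 0 (suc m))            ≡⟨ ext-factor (suc m) ⟩
        factor x 0 (P (suc m))                ≡⟨ cong (factor x 0) (P-suc m) ⟩
        factor x 0 (P m + length (φ (x m)))   ≡⟨ factor-+ x 0 (P m) _ ⟩
        factor x 0 (P m) ++ factor x (P m) (length (φ (x m))) ∎)
        where open ≡-Reasoning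

      -- The prefix of length `P m` is itself an image, so applying φ multiplies its length by
      -- exactly k. This is the source of the uniformity of `z`.
      P-P : ∀ m → P (P m) ≡ P m * k
      P-P m = trans (cong (length ∘ ext φ) (sym (ext-factor m))) (length-ext² (factor-closed m))

      P-mono : ∀ {m n} → m ≤ n → P m ≤ P n
      P-mono {m} {n} m≤n with d , refl ← m≤n⇒∃[o]m+o≡n m≤n = begin
        P m                                            ≤⟨ m≤m+n (P m) _ ⟩
        P m + length (ext φ (factor x m d))            ≡⟨ length-++ (ext φ (factor x 0 m)) ⟨
        length (ext φ (factor x 0 m) ++ ext φ (factor x m d))
          ≡⟨ cong length (concatMap-++ φ (factor x 0 m) _) ⟨
        length (ext φ (factor x 0 m ++ factor x m d))  ≡⟨ cong (length ∘ ext φ) (factor-+ x 0 m d) ⟨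
        P (m + d)                                      ∎
        where open ≤-Reasoning

      P-unbounded : ∀ n → ∃ λ m → n < P m
      P-unbounded n with proj₂ prolongable (suc n)
      ... | suc i , n< = length (iter φ i [ a ]) ,
        subst (n <_) (cong (length ∘ ext φ) (iter-prefix i)) n<
      -- The zeroth iterate is a single letter, so n = 0 here, and `P 1` = A > 0 suffices.
      ... | zero , s≤s z≤n = 1 , subst (0 <_)
        (trans (sym (cong length (++-identityʳ (φ a)))) (cong (length ∘ ext φ) (iter-prefix 0)))
        (n≢0⇒n>0 A≢0)

      -- Position n of x = φ(x) lies in the image of the letter x m, at offset j.
      Parent : ℕ → ℕ → ℕ → Set
      Parent n m j = n ≡ P m + j × j < length (φ (x m))

      parent-below : ∀ M {n} → n < P M → ∃₂ (Parent n)
      parent-below (suc M) {n} n<P with n <? P M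
      ... | yes n<PM = parent-below M n<PM
      ... | no  n≮PM = M , n ∸ P M , sym eq ,
        +-cancelˡ-< (P M) _ _ (subst₂ _<_ (sym eq) (P-suc M) n<P)
        where eq = m+[n∸m]≡n (≮⇒≥ n≮PM)

      parent : ∀ n → ∃₂ (Parent n)
      parent n = let M , n<P = P-unbounded n in parent-below M n<P

      parent-≮ : ∀ {n m j m′ j′} → Parent n m j → Parent n m′ j′ → ¬ m < m′
      parent-≮ {n} {m} {j} {m′} {j′} (n≡ , j<) (n≡′ , _) m<m′ = <-irrefl refl (begin-strict
        n                         ≡⟨ n≡ ⟩
        P m + j                   <⟨ +-monoʳ-< (P m) j< ⟩
        P m + length (φ (x m))    ≡⟨ P-suc m ⟨
        P (suc m)                 ≤⟨ P-mono m<m′ ⟩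
        P m′                      ≤⟨ m≤m+n (P m′) j′ ⟩
        P m′ + j′                 ≡⟨ n≡′ ⟨
        n                         ∎)
        where open ≤-Reasoning

      -- The index m is forgotten and only its letter kept, which leaves finitely many values.
      z : ℕ → ℕ × ℕ
      z n = let m , j , _ = parent n in x m , j

      z-parent : ∀ {n m j} → Parent n m j → z n ≡ (x m , j)
      z-parent {n} {m} {j} p with m′ , j′ , p′ ← parent n with <-cmp m m′
      ... | tri< m<m′ _ _ = contradiction m<m′ (parent-≮ p p′)
      ... | tri> _ _ m′<m = contradiction m′<m (parent-≮ p′ p)
      ... | tri≈ _ refl _ = cong (x m ,_) (+-cancelˡ-≡ (P m) j′ j (trans (sym (proj₁ p′)) (proj₁ p)))

      -- Parent letter and offset of position t of ext φ w; (0 , 0) is a junk value for t out of range.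
      locate : Word → ℕ → ℕ × ℕ
      locate []      t = 0 , 0
      locate (b ∷ w) t with t <? length (φ b)
      ... | yes _ = b , t
      ... | no  _ = locate w (t ∸ length (φ b))

      -- Skipping the image of the first letter of w raises m by one and lowers t by the length of
      -- that image, leaving the position `P m + t` unchanged.
      z-locate : ∀ w m {t} → w ≡ factor x m (length w) → t < length (ext φ w) →
        z (P m + t) ≡ locate w t
      z-locate (b ∷ w) m {t} eq t<
        with refl ← trans (∷-injectiveˡ eq) (cong x (+-identityʳ m))
        with t <? length (φ b)
      ... | yes t<φ = z-parent (refl , t<φ)
      ... | no  t≮φ = trans (cong z next) (z-locate w (suc m)
          (trans (∷-injectiveʳ eq) (applyUpTo-cong (λ j → cong x (+-suc m j)) (length w)))
          (+-cancelˡ-< (length (φ b)) _ _ (subst₂ _<_ (sym t≡) (length-++ (φ b)) t<)))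
        where
        t≡ : length (φ b) + (t ∸ length (φ b)) ≡ t
        t≡ = m+[n∸m]≡n (≮⇒≥ t≮φ)
        next : P m + t ≡ P (suc m) + (t ∸ length (φ b))
        next = begin
          P m + t                                       ≡⟨ cong (P m +_) t≡ ⟨
          P m + (length (φ b) + (t ∸ length (φ b)))     ≡⟨ +-assoc (P m) _ _ ⟨
          P m + length (φ b) + (t ∸ length (φ b))       ≡⟨ cong (_+ (t ∸ length (φ b))) (P-suc m) ⟨
          P (suc m) + (t ∸ length (φ b))                ∎
          where open ≡-Reasoning

      ψ : ℕ × ℕ → ℕ → ℕ × ℕ
      ψ (b , j) r = locate (φ b) (r + j * k)

      -- For n = P m + j, position kn + r is P (P m) + (r + jk). The word φ(x m) starts at P m, so
      -- its image starts at P (P m), and r + jk is an offset inside that image.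
      z-rec : ∀ n {r} → r < k → z (r + n * k) ≡ ψ (z n) r
      z-rec n {r} r<k with m , j , n≡ , j< ← parent n = begin
        z (r + n * k)                ≡⟨ cong (λ n → z (r + n * k)) n≡ ⟩
        z (r + (P m + j) * k)        ≡⟨ cong z (lemma r (P m) j k) ⟩
        z (P m * k + (r + j * k))    ≡⟨ cong (λ p → z (p + (r + j * k))) (P-P m) ⟨
        z (P (P m) + (r + j * k))    ≡⟨ z-locate (φ (x m)) (P m) (φ-factor m) bound ⟩
        locate (φ (x m)) (r + j * k) ∎
        where
        open ≡-Reasoning
        lemma : ∀ r p j k → r + (p + j) * k ≡ p * k + (r + j * k)
        lemma = solve-∀
        -- r + jk < (j + 1)k ≤ |φ(x m)| k, the length of the image.
        bound : r + j * k < length (ext φ (φ (x m)))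
        bound = subst (r + j * k <_) (sym (length-φ² (x∈Σ' m)))
          (≤-trans (+-monoˡ-< (j * k) r<k) (*-monoˡ-≤ k j<))

      E : List (ℕ × ℕ)
      E = concatMap (λ b → map (b ,_) (upTo (length (φ b)))) Σ'

      z∈E : ∀ n → z n ∈ E
      z∈E n with m , j , _ , j< ← parent n =
        ∈-concatMap⁺ (λ b → map (b ,_) (upTo (length (φ b))))
          (lose (x∈Σ' m) (∈-map⁺ (x m ,_) (∈-upTo⁺ j<)))

      -- Additive classes in terms of parents

      T : ℕ × ℕ → ℕ
      T (b , j) = A * sum (take j (φ b))

      -- Complete images have mean letter B / A, so the prefix of length n = P m + j has A-fold sum
      -- (P m)B plus the part `T` from the incomplete last image. Adding jB to both sides trades P m
      -- for n without subtraction.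
      prefix-sum : ∀ n → A * sum (factor x 0 n) + proj₂ (z n) * B ≡ n * B + T (z n)
      prefix-sum n with m , j , n≡ , j< ← parent n = begin
        A * sum (factor x 0 n) + j * B
          ≡⟨ cong (λ w → A * sum w + j * B) split ⟩
        A * sum (ext φ (factor x 0 m) ++ t) + j * B
          ≡⟨ cong (λ s → A * s + j * B) (sum-++ (ext φ (factor x 0 m)) t) ⟩
        A * (sum (ext φ (factor x 0 m)) + sum t) + j * B
          ≡⟨ cong (_+ j * B) (*-distribˡ-+ A (sum (ext φ (factor x 0 m))) (sum t)) ⟩
        A * sum (ext φ (factor x 0 m)) + A * sum t + j * B
          ≡⟨ cong (λ s → s + A * sum t + j * B) image ⟩
        P m * B + A * sum t + j * B
          ≡⟨ lemma (P m) B (A * sum t) j ⟩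
        (P m + j) * B + A * sum t
          ≡⟨ cong (λ n → n * B + A * sum t) n≡ ⟨
        n * B + A * sum t ∎
        where
        open ≡-Reasoning
        t : Word
        t = take j (φ (x m))
        split : factor x 0 n ≡ ext φ (factor x 0 m) ++ t
        split = begin
          factor x 0 n                                 ≡⟨ cong (factor x 0) n≡ ⟩
          factor x 0 (P m + j)                         ≡⟨ factor-+ x 0 (P m) j ⟩
          factor x 0 (P m) ++ factor x (P m) j
            ≡⟨ cong₂ _++_ (ext-factor m) (trans (cong (take j) (φ-factor m)) (take-applyUpTo _ (<⇒≤ j<))) ⟨
          ext φ (factor x 0 m) ++ t                    ∎
        image : A * sum (ext φ (factor x 0 m)) ≡ P m * B
        image = subst₂ (λ u v → A * u ≡ P m * v)
          (cong sum (map-id (ext φ (factor x 0 m)))) (cong sum (map-id (φ a)))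
          (weigh-ext-φ id (factor-closed m))
        lemma : ∀ p b t j → p * b + t + j * b ≡ (p + j) * b + t
        lemma = solve-∀

      -- The deviation A · sum - nB of a factor of length n whose two ends have `z`-values q and q′,
      -- obtained as the difference of two instances of `prefix-sum`. It may be negative, hence the
      -- integers.
      excess : ℕ × ℕ → ℕ × ℕ → ℤ
      excess q q′ = (T q′ + proj₂ q * B) ⊖ (T q + proj₂ q′ * B)

      factor-sum : ∀ i n → ℤ.+ (A * sum (factor x i n)) ≡ ℤ.+ (n * B) ℤ.+ excess (z i) (z (i + n))
      factor-sum i n = begin
        ℤ.+ (A * sum (factor x i n))                            ≡⟨ ℤ.+-cancelˡ-⊖ minus (A * sum (factor x i n)) 0 ⟨
        (minus + A * sum (factor x i n)) ⊖ (minus + 0)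
          ≡⟨ cong₂ _⊖_ balance (+-identityʳ minus) ⟩
        (n * B + plus) ⊖ minus                                  ≡⟨ ℤ.distribʳ-⊖-+-pos (n * B) plus minus ⟨
        ℤ.+ (n * B) ℤ.+ excess (z i) (z (i + n)) ∎
        where
        open ≡-Reasoning
        plus minus : ℕ
        plus  = T (z (i + n)) + proj₂ (z i) * B
        minus = T (z i) + proj₂ (z (i + n)) * B
        total : A * sum (factor x 0 (i + n)) ≡ A * sum (factor x 0 i) + A * sum (factor x i n)
        total = trans (cong (λ w → A * sum w) (factor-+ x 0 i n))
          (trans (cong (A *_) (sum-++ (factor x 0 i) _)) (*-distribˡ-+ A (sum (factor x 0 i)) _))
        regroup₁ : ∀ p t s j′ → p + (t + j′ + s) ≡ (p + t) + (s + j′)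
        regroup₁ = solve-∀
        regroup₂ : ∀ α j s j′ → (α + j) + (s + j′) ≡ (α + s + j′) + j
        regroup₂ = solve-∀
        regroup₃ : ∀ i n b t j → (i + n) * b + t + j ≡ i * b + (n * b + (t + j))
        regroup₃ = solve-∀
        -- Adding iB lets `prefix-sum` be used at i and at i + n entirely within ℕ.
        balance : minus + A * sum (factor x i n) ≡ n * B + plus
        balance = +-cancelˡ-≡ (i * B) _ _ (begin
          i * B + (minus + A * sum (factor x i n))
            ≡⟨ regroup₁ (i * B) (T (z i)) (A * sum (factor x i n)) (proj₂ (z (i + n)) * B) ⟩
          (i * B + T (z i)) + (A * sum (factor x i n) + proj₂ (z (i + n)) * B)
            ≡⟨ cong (_+ (A * sum (factor x i n) + proj₂ (z (i + n)) * B)) (prefix-sum i) ⟨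
          (A * sum (factor x 0 i) + proj₂ (z i) * B) + (A * sum (factor x i n) + proj₂ (z (i + n)) * B)
            ≡⟨ regroup₂ (A * sum (factor x 0 i)) (proj₂ (z i) * B) (A * sum (factor x i n)) (proj₂ (z (i + n)) * B) ⟩
          (A * sum (factor x 0 i) + A * sum (factor x i n) + proj₂ (z (i + n)) * B) + proj₂ (z i) * B
            ≡⟨ cong (λ s → s + proj₂ (z (i + n)) * B + proj₂ (z i) * B) total ⟨
          (A * sum (factor x 0 (i + n)) + proj₂ (z (i + n)) * B) + proj₂ (z i) * B
            ≡⟨ cong (_+ proj₂ (z i) * B) (prefix-sum (i + n)) ⟩
          (i + n) * B + T (z (i + n)) + proj₂ (z i) * B
            ≡⟨ regroup₃ i n B (T (z (i + n))) (proj₂ (z i) * B) ⟩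
          i * B + (n * B + plus) ∎)

      excess⇒AddEq : ∀ n p q → excess (z p) (z (p + n)) ≡ excess (z q) (z (q + n)) →
        AddEq (factor x p n) (factor x q n)
      excess⇒AddEq n p q eq = trans (length-factor x p n) (sym (length-factor x q n)) ,
        *-cancelˡ-≡ _ _ A (ℤ.+-injective
          (trans (factor-sum p n) (trans (cong (ℤ._+_ (ℤ.+ (n * B))) eq) (sym (factor-sum q n)))))

      AddEq⇒excess : ∀ n p q → AddEq (factor x p n) (factor x q n) →
        excess (z p) (z (p + n)) ≡ excess (z q) (z (q + n))
      AddEq⇒excess n p q (_ , eq) = ∙-cancelˡ (ℤ.+ (n * B)) _ _
        (trans (sym (factor-sum p n)) (trans (cong (λ s → ℤ.+ (A * s)) eq) (factor-sum q n)))

    -- The base is generalised to a variable k′ so that it can be matched against 2 + i, the form on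
    -- which `rep` computes digits; bases 0 and 1 contradict `1<traceK`.
    additive-automaton : ∀ k′ → k ≡ k′ →
      Σ (DFAO k′) λ M → ∀ n → AddComplexityIs x n (run M (rep k′ n))
    additive-automaton zero          k≡ = contradiction (subst (1 <_) k≡ 1<traceK) λ ()
    additive-automaton (suc zero)    k≡ = contradiction (subst (1 <_) k≡ 1<traceK) λ { (s≤s ()) }
    additive-automaton (suc (suc i)) k≡ =
      let M , correct = count-values i (≡-dec _≟_ _≟_) ℤ._≟_ excess z ψ
                          (subst (λ k → ∀ n {r} → r < k → z (r + n * k) ≡ ψ (z n) r) k≡ z-rec) E z∈E
      in M , λ n → let pos , injective , covering = correct n in
           pos , (λ i j → injective i j ∘ AddEq⇒excess n (pos i) (pos j)) ,
           λ p → let i , eq = covering p in i , excess⇒AddEq n p (pos i) eq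

theorem3p10 : (Σ' : List ℕ) → Unique Σ' → (φ : ℕ → Word) → (a : ℕ)
    → (∀ b → b ∈ Σ' → All (_∈ Σ') (φ b)) → a ∈ Σ'
    → ParikhCollinear Σ' φ → Prolongable φ a
    → (x : ℕ → ℕ) → IsFixedPoint φ a x
    → Σ (DFAO (traceK Σ' φ)) λ M → ∀ n → AddComplexityIs x n (run M (rep (traceK Σ' φ) n))
theorem3p10 Σ' uniq φ a closed a∈Σ' collinear prolongable x fixed =
  additive-automaton Σ' uniq φ a closed a∈Σ' collinear prolongable x fixed (traceK Σ' φ) refl
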